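{- Let $i\ge 0$, let $K$ be a finite simplicial complex with $B_i(K)$ connected ($K$ is $(i+1)$-path connected), and let $\Sigma$ be an $i$-motif of $K$. Then $B_i(K^\Sigma)$ is balanced if and only if $B_i(K)$ is balanced.
   Context: $S_j(K)$ is the set of faces of cardinality $j+1$. For a collection $S$ of faces of $K$: the closure $\mathrm{cl}\,S$ is the smallest subcomplex containing $S$; the star $\mathrm{st}\,S$ is the set of faces of $K$ having a face in $S$; the link is $\mathrm{lk}\,S=\mathrm{cl}\,\mathrm{st}\,S-\mathrm{st}\,\mathrm{cl}\,S$. A subcomplex $\Sigma$ of $K$ is an $i$-motif if (1) whenever $F_1,F_2\in\Sigma$ and $F_1,F_2\subset F\in K$, then $F\in\Sigma$; and (2) $\dim\mathrm{lk}\,\Sigma=i$. Duplication: let $V(\Sigma)=\{v_0,\dots,v_k\}$, $V(\mathrm{lk}\,\Sigma)=\{u_0,\dots,u_m\}$, take new vertices $v_0',\dots,v_k'$, and set $K^\Sigma=K\cup\{\{v'_{i_0},\dots,v'_{i_l},u_{j_1},\dots,u_{j_s}\}:\{v_{i_0},\dots,v_{i_l},u_{j_1},\dots,u_{j_s}\}\in K\}$. For a complex $L$ with an orientation, $B_i(L)$ is the signed bipartite graph on $S_i(L)\cup S_{i+1}(L)$ with edges $\{F,\bar F\}$ for $F\subset\bar F$, signed by the boundary incidence sign $\mathrm{sgn}([F],\partial[\bar F])\in\{\pm1\}$ ($(-1)^j$ if $F$ is $\bar F$ minus its $j$-th vertex with agreeing orientation, negated otherwise). A signed graph is balanced if every cycle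 has positive sign product; this is independent of the orientation. -}

module Defs where

open import Data.Nat.Base as ℕ using (ℕ; zero; suc; _≤_)
open import Data.Fin.Base using (Fin)
open import Data.Fin.Properties as Fin using (_<?_)
open import Data.Fin.Subset using (Subset; _∈_; _⊆_; _∪_; ⁅_⁆; ⊥; ∣_∣; Nonempty)
open import Data.Fin.Subset.Properties
  using (_∈?_; _⊆?_; nonempty?; anySubset?; ∉⊥; ⊆-antisym; drop-there;
         p⊆p∪q; q⊆p∪q; x∈p∪q⁻; x∈p∪q⁺)
open import Data.Vec.Base as Vec using ([]; _∷_; _++_; here; there)
open import Data.Vec.Properties using (++-injective)
open import Data.List.Base using (List; []; _∷_; _∷ʳ_; length; filter; takeWhile)
open import Data.List.Membership.Propositional using () renaming (_∈_ to _∈ˡ_)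
open import Data.List.Relation.Unary.Linked using (Linked)
open import Data.List.Relation.Unary.Unique.Propositional using (Unique)
open import Data.Sign.Base using (Sign; +; opposite; _*_)
open import Data.Refinement.Base using (Refinement; value)
open import Data.Product.Base using (∃; _×_; _,_; proj₂)
open import Data.Sum.Base as Sum using (_⊎_; inj₁; inj₂; [_,_]′)
open import Data.Empty using (⊥-elim) renaming (⊥ to ⊥₀)
open import Function.Base using (_∘_; id)
open import Function.Bundles using (_⇔_)
open import Level using (0ℓ)
open import Relation.Binary.Construct.Closure.ReflexiveTransitive using (Star)
open import Relation.Binary.PropositionalEquality using (_≡_; _≢_; refl)
open import Relation.Nullary using (Dec; yes; no; ¬_; ¬?; _×-dec_; _⊎-dec_; _→-dec_)
open import Relation.Nullary.Decidable using (map′)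
open import Relation.Unary using (Pred; Decidable)

------------------------------------------------------------------------
-- Simplicial complexes

-- The vertices are elements of Fin n; not every element of Fin n has to
-- be a vertex.  The empty set is not a face: if it were, st (cl C) would
-- contain every face, and every link would be empty.

record Complex (n : ℕ) : Set₁ where
  field
    Face     : Pred (Subset n) 0ℓ
    face?    : Decidable Face
    nonempty : ∀ {F} → Face F → Nonempty F
    down     : ∀ {F G} → Face F → Nonempty G → G ⊆ F → Face G

open Complex public

private
  variable
    n : ℕ

-- S K j: the faces of cardinality j + 1.  The proof component is
-- irrelevant, so two elements are equal as soon as the subsets are.

S : Complex n → ℕ → Set
S {n} K j = Refinement (Subset n) λ F → Face K F × ∣ F ∣ ≡ suc j

cl : Pred (Subset n) 0ℓ → Pred (Subset n) 0ℓ
cl C F = Nonempty F × ∃ λ G → C G × F ⊆ G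

st : Complex n → Pred (Subset n) 0ℓ → Pred (Subset n) 0ℓ
st K C F = Face K F × ∃ λ G → C G × G ⊆ F

lk : Complex n → Pred (Subset n) 0ℓ → Pred (Subset n) 0ℓ
lk K C F = cl (st K C) F × (¬ st K (cl C) F)

Vertices : Pred (Subset n) 0ℓ → Pred (Fin n) 0ℓ
Vertices C v = C ⁅ v ⁆

HasDim : Pred (Subset n) 0ℓ → ℕ → Set
HasDim C i = (∃ λ F → C F × ∣ F ∣ ≡ suc i) × (∀ {F} → C F → ∣ F ∣ ≤ suc i)

-- cl C is the smallest subcomplex of K containing C.

module _ (K : Complex n) {C : Pred (Subset n) 0ℓ} (C⊆K : ∀ {F} → C F → Face K F) where

  cl-⊇ : ∀ {F} → C F → cl C F
  cl-⊇ F∈C = nonempty K (C⊆K F∈C) , _ , F∈C , id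

  cl-face : ∀ {F} → cl C F → Face K F
  cl-face (ne , G , G∈C , F⊆G) = down K (C⊆K G∈C) ne F⊆G

  cl-down : ∀ {F G} → cl C F → Nonempty G → G ⊆ F → cl C G
  cl-down (_ , H , H∈C , F⊆H) ne G⊆F = ne , H , H∈C , F⊆H ∘ G⊆F

  cl-least : (L : Complex n) → (∀ {F} → C F → Face L F) → ∀ {F} → cl C F → Face L F
  cl-least L C⊆L (ne , G , G∈C , F⊆G) = down L (C⊆L G∈C) ne F⊆G

cl? : {C : Pred (Subset n) 0ℓ} → Decidable C → Decidable (cl C)
cl? C? F = nonempty? F ×-dec anySubset? λ G → C? G ×-dec (F ⊆? G)

st? : (K : Complex n) {C : Pred (Subset n) 0ℓ} → Decidable C → Decidable (st K C)
st? K C? F = face? K F ×-dec anySubset? λ G → C? G ×-dec (G ⊆? F)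

lk? : (K : Complex n) {C : Pred (Subset n) 0ℓ} → Decidable C → Decidable (lk K C)
lk? K C? F = cl? (st? K C?) F ×-dec ¬? (st? K (cl? C?) F)

------------------------------------------------------------------------
-- Motifs and duplication

-- In `full` the faces F₁ and F₂ are distinct.  With F₁ = F₂ allowed, the
-- condition would force st Σ ⊆ Σ, the link would be empty, and there
-- would be no i-motif with i ≥ 0.

record IsMotif (i : ℕ) (K Σ : Complex n) : Set where
  field
    subcomplex : ∀ {F} → Face Σ F → Face K F
    full       : ∀ {F₁ F₂ F} → Face Σ F₁ → Face Σ F₂ → F₁ ≢ F₂ →
                 F₁ ⊆ F → F₂ ⊆ F → Face K F → Face Σ F
    link-dim   : HasDim (lk K (Face Σ)) i

-- The ground set is Fin (n + n): the first summand carries the vertices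
-- of K, and the copy v′ of v is the element n ↑ʳ v.  So U ++ W stands for
-- U ∪ { v′ ∣ v ∈ W }.

data DupFace (K Σ : Complex n) : Pred (Subset (n ℕ.+ n)) 0ℓ where
  old : ∀ {F} → Face K F → DupFace K Σ (F ++ ⊥)
  new : ∀ {W U} → Nonempty W →
        (∀ {v} → v ∈ W → Vertices (Face Σ) v) →
        (∀ {u} → u ∈ U → Vertices (lk K (Face Σ)) u) →
        Face K (W ∪ U) → DupFace K Σ (U ++ W)

∈-++ˡ : ∀ {m} {U : Subset m} {W : Subset n} {x} → x ∈ U → ∃ (_∈ U ++ W)
∈-++ˡ here        = _ , here
∈-++ˡ (there x∈U) = _ , there (proj₂ (∈-++ˡ x∈U))

∈-++ʳ : ∀ {m} (U : Subset m) {W : Subset n} {x} → x ∈ W → ∃ (_∈ U ++ W)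
∈-++ʳ []      x∈W = _ , x∈W
∈-++ʳ (_ ∷ U) x∈W = _ , there (proj₂ (∈-++ʳ U x∈W))

∈-++⁻ : ∀ {m} (U : Subset m) {W : Subset n} → Nonempty (U ++ W) → Nonempty U ⊎ Nonempty W
∈-++⁻ []      ne                = inj₂ ne
∈-++⁻ (_ ∷ U) (_ , here)        = inj₁ (_ , here)
∈-++⁻ (_ ∷ U) (_ , there x∈U++W) =
  Sum.map₁ (λ (_ , x∈U) → _ , there x∈U) (∈-++⁻ U (_ , x∈U++W))

++-⊆ˡ : ∀ {m} {U U′ : Subset m} {W W′ : Subset n} → (U′ ++ W′) ⊆ (U ++ W) → U′ ⊆ U
++-⊆ˡ {U = _ ∷ _} s here with here ← s here = here
++-⊆ˡ {U = _ ∷ _} {U′ = _ ∷ _} s (there x∈U′) =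
  there (++-⊆ˡ (λ p → drop-there (s (there p))) x∈U′)

++-⊆ʳ : ∀ {m} (U U′ : Subset m) {W W′ : Subset n} → (U′ ++ W′) ⊆ (U ++ W) → W′ ⊆ W
++-⊆ʳ []      []       s = s
++-⊆ʳ (_ ∷ U) (_ ∷ U′) s = ++-⊆ʳ U U′ (λ p → drop-there (s (there p)))

empty≡⊥ : {W : Subset n} → (¬ Nonempty W) → W ≡ ⊥
empty≡⊥ ¬ne = ⊆-antisym (λ x∈W → ⊥-elim (¬ne (_ , x∈W))) (λ x∈⊥ → ⊥-elim (∉⊥ x∈⊥))

∪-mono : {U U′ W W′ : Subset n} → W′ ⊆ W → U′ ⊆ U → (W′ ∪ U′) ⊆ (W ∪ U)
∪-mono {W′ = W′} w u = x∈p∪q⁺ ∘ Sum.map w u ∘ x∈p∪q⁻ W′ _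

DupFace′ : (K Σ : Complex n) → Subset n → Subset n → Set
DupFace′ K Σ U W =
  (W ≡ ⊥ × Face K U) ⊎
  (Nonempty W × (∀ v → v ∈ W → Vertices (Face Σ) v) ×
   (∀ u → u ∈ U → Vertices (lk K (Face Σ)) u) × Face K (W ∪ U))

to′ : ∀ {K Σ : Complex n} {A} → DupFace K Σ A →
      ∃ λ U → ∃ λ W → A ≡ U ++ W × DupFace′ K Σ U W
to′ (old f)       = _ , _ , refl , inj₁ (refl , f)
to′ (new w v u f) = _ , _ , refl , inj₂ (w , (λ _ → v) , (λ _ → u) , f)

from′ : ∀ {K Σ : Complex n} {U W} → DupFace′ K Σ U W → DupFace K Σ (U ++ W)
from′ (inj₁ (refl , f))      = old f
from′ (inj₂ (w , v , u , f)) = new w (v _) (u _) f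

dupFace′? : (K Σ : Complex n) → ∀ U W → Dec (DupFace′ K Σ U W)
dupFace′? K Σ U W =
  (map′ empty≡⊥ (λ { refl (_ , x∈⊥) → ∉⊥ x∈⊥ }) (¬? (nonempty? W)) ×-dec face? K U) ⊎-dec
  (nonempty? W ×-dec
   Fin.all? (λ v → (v ∈? W) →-dec face? Σ ⁅ v ⁆) ×-dec
   Fin.all? (λ u → (u ∈? U) →-dec lk? K (face? Σ) ⁅ u ⁆) ×-dec
   face? K (W ∪ U))

dupFace? : (K Σ : Complex n) → Decidable (DupFace K Σ)
dupFace? {n} K Σ A with Vec.splitAt n A
... | U , W , refl = map′ from′ back (dupFace′? K Σ U W)
  where
  back : DupFace K Σ (U ++ W) → DupFace′ K Σ U W
  back d with to′ d
  ... | U′ , W′ , eq , d′ with ++-injective U U′ eq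
  ... | refl , refl = d′

dup-nonempty : (K Σ : Complex n) → ∀ {A} → DupFace K Σ A → Nonempty A
dup-nonempty K Σ (old f)               = ∈-++ˡ (proj₂ (nonempty K f))
dup-nonempty K Σ (new {U = U} w _ _ _) = ∈-++ʳ U (proj₂ w)

dup-down : (K Σ : Complex n) → ∀ {A B} → DupFace K Σ A → Nonempty B → B ⊆ A → DupFace K Σ B
dup-down {n} K Σ {B = B} d ne B⊆A with Vec.splitAt n B
dup-down K Σ (old {F} f) ne B⊆A | U′ , W′ , refl =
  from′ (inj₁ (W′≡⊥ , down K f ([ id , (λ (_ , p) → ⊥-elim (∉⊥ (++-⊆ʳ F U′ B⊆A p))) ]′ (∈-++⁻ U′ ne))
                            (++-⊆ˡ B⊆A)))
  where
  W′≡⊥ : W′ ≡ ⊥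
  W′≡⊥ = empty≡⊥ λ (_ , p) → ∉⊥ (++-⊆ʳ F U′ B⊆A p)
dup-down K Σ (new {W} {U} w v u f) ne B⊆A | U′ , W′ , refl with nonempty? W′
... | yes w′ = new w′ (v ∘ ++-⊆ʳ U U′ B⊆A) (u ∘ ++-⊆ˡ B⊆A)
                 (down K f (_ , p⊆p∪q U′ (proj₂ w′)) (∪-mono (++-⊆ʳ U U′ B⊆A) (++-⊆ˡ B⊆A)))
... | no ¬w′ = from′ (inj₁ (empty≡⊥ ¬w′ ,
                 down K f ([ id , (λ w′ → ⊥-elim (¬w′ w′)) ]′ (∈-++⁻ U′ ne))
                          (q⊆p∪q W U ∘ ++-⊆ˡ B⊆A)))

infixl 8 _^_

_^_ : Complex n → Complex n → Complex (n ℕ.+ n)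
K ^ Σ = record
  { Face     = DupFace K Σ
  ; face?    = dupFace? K Σ
  ; nonempty = dup-nonempty K Σ
  ; down     = dup-down K Σ
  }

------------------------------------------------------------------------
-- Orientations

record Ordering (F : Subset n) : Set where
  field
    list     : List (Fin n)
    unique   : Unique list
    complete : ∀ {v} → v ∈ˡ list ⇔ v ∈ F

open Ordering public

-- An orientation of a face is an ordering of its vertices up to even
-- permutations; it is given by a representative, and only the sign of
-- the permutation between two representatives is used below.

Orientation : Complex n → Set
Orientation K = ∀ {j} (F : S K j) → Ordering (value F)

-1^_ : ℕ → Sign
-1^ zero  = +
-1^ suc k = opposite (-1^ k)

inversions : List (Fin n) → ℕ
inversions []       = 0
inversions (x ∷ xs) = length (filter (_<? x) xs) ℕ.+ inversions xs

-- For two orderings of the same set, the sign of the permutation taking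
-- one to the other.

permSign : List (Fin n) → List (Fin n) → Sign
permSign xs ys = (-1^ inversions xs) * (-1^ inversions ys)

-- sgn([F], ∂[F̄]) for F ⊂ F̄ of codimension one.  If [F̄] = [v₀, …, vₖ] and
-- F = F̄ − {vⱼ}, then takeWhile (_∈? F) yields v₀, …, vⱼ₋₁, so its length
-- is j, and filter (_∈? F) yields the ordering of F induced by F̄.

incidence : {F F̄ : Subset n} → Ordering F → Ordering F̄ → Sign
incidence {F = F} o ō =
  (-1^ length (takeWhile (_∈? F) (list ō))) * permSign (filter (_∈? F) (list ō)) (list o)

------------------------------------------------------------------------
-- Signed graphs

-- The values of `sign` on non-adjacent pairs are irrelevant.

record SignedGraph : Set₁ where
  field
    Vertex   : Set
    _~_      : Vertex → Vertex → Set
    ~-sym    : ∀ {u v} → u ~ v → v ~ u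
    sign     : Vertex → Vertex → Sign
    sign-sym : ∀ u v → sign u v ≡ sign v u

module _ (G : SignedGraph) where
  open SignedGraph G

  Connected : Set
  Connected = ∀ u v → Star _~_ u v

  -- The cycle v – v₁ – … – vₖ – v, for vs = v₁, …, vₖ.

  record IsCycle (v : Vertex) (vs : List Vertex) : Set where
    field
      long     : 2 ≤ length vs
      distinct : Unique (v ∷ vs)
      linked   : Linked _~_ (v ∷ (vs ∷ʳ v))

  walkSign : List Vertex → Sign
  walkSign []           = +
  walkSign (_ ∷ [])     = +
  walkSign (u ∷ v ∷ vs) = sign u v * walkSign (v ∷ vs)

  Balanced : Set
  Balanced = ∀ {v vs} → IsCycle v vs → walkSign (v ∷ (vs ∷ʳ v)) ≡ +

B : (i : ℕ) (L : Complex n) → Orientation L → SignedGraph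
B i L o = record
  { Vertex   = S L i ⊎ S L (suc i)
  ; _~_      = _~_
  ; ~-sym    = λ {u} {v} → ~-sym u v
  ; sign     = sign
  ; sign-sym = sign-sym
  }
  where
  _~_ : S L i ⊎ S L (suc i) → S L i ⊎ S L (suc i) → Set
  inj₁ F ~ inj₂ F̄ = value F ⊆ value F̄
  inj₂ F̄ ~ inj₁ F = value F ⊆ value F̄
  _      ~ _      = ⊥₀

  ~-sym : ∀ u v → u ~ v → v ~ u
  ~-sym (inj₁ _) (inj₂ _) p = p
  ~-sym (inj₂ _) (inj₁ _) p = p

  sign : S L i ⊎ S L (suc i) → S L i ⊎ S L (suc i) → Sign
  sign (inj₁ F) (inj₂ F̄) = incidence (o F) (o F̄)
  sign (inj₂ F̄) (inj₁ F) = incidence (o F) (o F̄)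
  sign _        _        = +

  sign-sym : ∀ u v → sign u v ≡ sign v u
  sign-sym (inj₁ _) (inj₁ _) = refl
  sign-sym (inj₁ _) (inj₂ _) = refl
  sign-sym (inj₂ _) (inj₁ _) = refl
  sign-sym (inj₂ _) (inj₂ _) = refl

{-# OPTIONS --safe #-}

-- Balance pulls back along nondegenerate simplicial maps L → K, that is,
-- maps injective on every face.  Such a map induces a homomorphism from
-- B i L to B i K which preserves signs up to a switching, and in a
-- balanced signed graph all closed walks (not only cycles) are positive,
-- by loop erasure.  Both directions are instances: the inclusion
-- K → K ^ Σ, and the projection K ^ Σ → K with v′ ↦ v, which is
-- nondegenerate because the vertices of lk Σ lie outside Σ.
--
-- For orderings o of F and ō of F̄ = F ∪ {x}, the incidence sign is
-- (-1)^(inv o + inv ō + #{y ∈ F ∣ y < x}), so changing the orientation is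
-- a switching.  With the vertices of all faces listed in the order of
-- Fin m, and the images listed in the order induced by the map, the
-- incidence signs in L and K agree.

module Submission where

open import Defs
open import Data.Bool.Properties as Bool using ()
open import Data.Fin.Base as Fin using (Fin; zero; suc; splitAt; _↑ˡ_; _↑ʳ_)
open import Data.Fin.Properties as Fin using (_<?_; splitAt-↑ˡ; splitAt-↑ʳ)
open import Data.Fin.Subset using (Subset; inside; outside; _∈_; _∉_; _⊆_; _∪_; ∣_∣)
  renaming (⊥ to ∅)
open import Data.Fin.Subset.Properties
  using (_∈?_; drop-there; ∉⊥; x∈p∪q⁺; x∈p∪q⁻; ∪-comm; ∪-identityʳ)
open import Data.Irrelevant using ([_])
open import Data.List.Base
  using (List; []; _∷_; _∷ʳ_; _++_; map; length; filter; takeWhile; allFin; tabulate)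
open import Data.List.Membership.DecPropositional using () renaming (_∈?_ to member?)
open import Data.List.Membership.Propositional using () renaming (_∈_ to _∈ˡ_)
open import Data.List.Membership.Propositional.Properties
  using (∈-allFin; ∈-filter⁺; ∈-filter⁻; ∈-map⁺; ∈-map⁻; ∈-∃++; ∈-++⁺ʳ)
  renaming (∈-++⁻ to ∈ˡ-++⁻)
open import Data.List.Membership.Propositional.Properties.WithK using (unique∧set⇒bag)
open import Data.List.Properties
  using (filter-all; filter-++; filter-accept; filter-reject; filter-complete; length-map; map-++)
open import Data.List.Relation.Binary.BagAndSetEquality using (∼bag⇒↭)
open import Data.List.Relation.Binary.Permutation.Propositional using (_↭_; ↭-sym)
open import Data.List.Relation.Binary.Permutation.Propositional.Properties
  using (filter-↭; ↭-length; shift; ∈-resp-↭)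
open import Data.List.Relation.Unary.All as All using (All; []; _∷_)
open import Data.List.Relation.Unary.All.Properties as All using (all-filter; ¬Any⇒All¬)
open import Data.List.Relation.Unary.AllPairs using ([]; _∷_)
open import Data.List.Relation.Unary.Any using (here; there)
open import Data.List.Relation.Unary.Linked using (Linked; [-]; _∷_)
open import Data.List.Relation.Unary.Unique.Propositional using (Unique)
open import Data.List.Relation.Unary.Unique.Propositional.Properties using (allFin⁺; filter⁺)
open import Data.Nat.Base as ℕ using (ℕ; suc; s≤s; z≤n)
open import Data.Nat.Properties as ℕ using (suc-injective)
open import Data.Product.Base using (∃; ∃₂; _×_; _,_; proj₁; proj₂)
open import Data.Refinement.Base using (_,_; value)
open import Data.Refinement.Properties as Refinement using ()
open import Data.Sign.Base using (Sign; +; -; _*_)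
open import Data.Sign.Properties using (s*s≡+; *-assoc; *-comm; *-commutativeMonoid)
open import Data.Sum.Base using (_⊎_; inj₁; inj₂; [_,_]′)
open import Data.Sum.Properties as Sum using ()
open import Data.Vec.Base as Vec using ([]; _∷_; here; there) renaming (_++_ to _++ᵥ_)
open import Data.Vec.Properties as Vec using ()
open import Function.Base using (_∘_; id)
open import Function.Bundles using (_⇔_; mk⇔; Equivalence)
open import Level using (0ℓ)
open import Relation.Binary.Definitions using (DecidableEquality; tri<; tri≈; tri>)
open import Relation.Binary.PropositionalEquality
  using (_≡_; _≢_; refl; sym; trans; cong; cong₂; subst; ≢-sym; module ≡-Reasoning)
open import Relation.Nullary using (¬_; yes; no; contradiction)
open import Relation.Nullary.Decidable using (recompute; _×-dec_)
open import Relation.Unary using (Pred; Decidable)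

open import Algebra.Solver.CommutativeMonoid *-commutativeMonoid using (solve; _⊜_; _⊕_)
open Equivalence using (to; from)
open ≡-Reasoning

private
  variable
    m n : ℕ

-- Balance of signed graphs

module _ {A : Set} where

  -- The splitting vertex `x` is kept in both halves: in loop erasure the first half lists the
  -- vertices of the closed path that is cut off, the second those of the path that remains.
  Unique-++⁻ : ∀ xs {x : A} {ys} → Unique (xs ++ x ∷ ys) → Unique (x ∷ xs) × Unique (x ∷ ys)
  Unique-++⁻ []       u        = [] ∷ [] , u
  Unique-++⁻ (y ∷ xs) (y∉ ∷ u) with Unique-++⁻ xs u | All.++⁻ xs y∉
  ... | x∉xs ∷ uxs , uys | y∉xs , y≢x ∷ _ = (≢-sym y≢x ∷ x∉xs) ∷ y∉xs ∷ uxs , uys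

  Unique-shift : ∀ xs {x : A} {ys} → Unique (xs ++ x ∷ ys) → Unique (x ∷ xs ++ ys)
  Unique-shift []       u        = u
  Unique-shift (y ∷ xs) (y∉ ∷ u) with Unique-shift xs u | All.++⁻ xs y∉
  ... | x∉ ∷ u′ | y∉xs , y≢x ∷ y∉ys = (≢-sym y≢x ∷ x∉) ∷ All.++⁺ y∉xs y∉ys ∷ u′

-- Walks and loop erasure

module Walks (G : SignedGraph) where
  open SignedGraph G

  -- The list omits the start and includes the end, so `u ∷ vs` is the argument of `walkSign`.
  -- Vertices may repeat.
  data Walk (u : Vertex) : List Vertex → Vertex → Set where
    []  : Walk u [] u
    _∷_ : ∀ {v vs w} → u ~ v → Walk v vs w → Walk u (v ∷ vs) w

  end∈ : ∀ {u v vs w} → Walk u (v ∷ vs) w → w ∈ˡ v ∷ vs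
  end∈ (_ ∷ [])    = here refl
  end∈ (_ ∷ e ∷ p) = there (end∈ (e ∷ p))

  -- Cuts a walk at a visit to `x`. The first piece is returned as `Linked` because this is the form
  -- in which `IsCycle` takes it.
  split : ∀ {u w} as {x bs} → Walk u (as ++ x ∷ bs) w →
          Linked _~_ (u ∷ (as ∷ʳ x)) × Walk x bs w ×
          walkSign G (u ∷ as ++ x ∷ bs) ≡ walkSign G (u ∷ (as ∷ʳ x)) * walkSign G (x ∷ bs)
  split {u} [] {x} {bs} (e ∷ p) = e ∷ [-] , p , sym (*-assoc (sign u x) + (walkSign G (x ∷ bs)))
  split {u} (a ∷ as) {x} {bs} (e ∷ p) with split as p
  ... | l , q , eq = e ∷ l , q ,
    trans (cong (sign u a *_) eq)
          (sym (*-assoc (sign u a) (walkSign G (a ∷ (as ∷ʳ x))) (walkSign G (x ∷ bs))))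

  module _ (_≟_ : DecidableEquality Vertex) (irrefl : ∀ {v} → ¬ v ~ v) (bal : Balanced G) where

    -- Length two is not a cycle in the sense of IsCycle, but then an edge
    -- is traversed back and forth.
    closed-path-sign : ∀ {u x} as → Linked _~_ (u ∷ ((x ∷ as) ∷ʳ u)) → Unique (u ∷ x ∷ as) →
                       walkSign G (u ∷ ((x ∷ as) ∷ʳ u)) ≡ +
    closed-path-sign {u} {x} [] _ _ = begin
      sign u x * (sign x u * +) ≡⟨ cong (λ s → sign u x * (s * +)) (sign-sym x u) ⟩
      sign u x * (sign u x * +) ≡⟨ *-assoc (sign u x) (sign u x) + ⟨
      (sign u x * sign u x) * + ≡⟨ cong (_* +) (s*s≡+ (sign u x)) ⟩
      +                         ∎
    closed-path-sign (_ ∷ _) l u = bal record { long = s≤s (s≤s z≤n) ; distinct = u ; linked = l }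

    -- Induction on the walk: once the tail is a path, a return to `u` closes up exactly one path,
    -- which is positive by balance, so deleting it keeps the sign.
    loop-erasure : ∀ {u vs w} → Walk u vs w →
                   ∃ λ ws → Walk u ws w × Unique (u ∷ ws) × walkSign G (u ∷ ws) ≡ walkSign G (u ∷ vs)
    loop-erasure [] = [] , [] , [] ∷ [] , refl
    loop-erasure {u} {x ∷ vs} (e ∷ p) with loop-erasure p
    ... | ws , q , uq , eq with member? _≟_ u (x ∷ ws)
    ... | no u∉ = x ∷ ws , e ∷ q , ¬Any⇒All¬ _ u∉ ∷ uq , cong (sign u x *_) eq
    ... | yes u∈ with ∈-∃++ u∈
    -- Here `x` is `u` itself, so the first edge would be a loop.
    ... | [] , _ , refl = contradiction e irrefl
    ... | _ ∷ as , bs , refl with split (x ∷ as) (e ∷ q) | Unique-++⁻ (x ∷ as) uq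
    ... | l , r , eq′ | uas , ubs = bs , r , ubs , (begin
      walkSign G (u ∷ bs)
        ≡⟨ cong (_* walkSign G (u ∷ bs)) (closed-path-sign as l uas) ⟨
      walkSign G (u ∷ ((x ∷ as) ∷ʳ u)) * walkSign G (u ∷ bs)
        ≡⟨ eq′ ⟨
      sign u x * walkSign G (x ∷ as ++ u ∷ bs)
        ≡⟨ cong (sign u x *_) eq ⟩
      sign u x * walkSign G (x ∷ vs) ∎)

    closed-walk-sign : ∀ {v vs} → Walk v vs v → walkSign G (v ∷ vs) ≡ +
    closed-walk-sign p with loop-erasure p
    ... | []     , _ , _        , eq = sym eq
    -- A nonempty path from `v` to `v` would list `v` twice.
    ... | _ ∷ _  , q , v∉ ∷ _ , _  = contradiction refl (All.lookup v∉ (end∈ q))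

-- Pullback of balance along a homomorphism with switching

module _ (G H : SignedGraph) where
  private
    module G = SignedGraph G
    module H = SignedGraph H
  open Walks H

  module _ (π : G.Vertex → H.Vertex) (ε : G.Vertex → Sign)
           (π-~ : ∀ {u v} → u G.~ v → π u H.~ π v)
           (switch : ∀ {u v} → u G.~ v → G.sign u v ≡ (ε u * ε v) * H.sign (π u) (π v)) where

    -- The switching factors telescope: each inner vertex contributes `ε v` twice, and only the two
    -- ends survive.
    project : ∀ {u} vs {w} → Linked G._~_ (u ∷ (vs ∷ʳ w)) →
              Walk (π u) (map π (vs ∷ʳ w)) (π w) ×
              walkSign G (u ∷ (vs ∷ʳ w)) ≡ (ε u * ε w) * walkSign H (map π (u ∷ (vs ∷ʳ w)))
    project {u} [] {w} (e ∷ [-]) = π-~ e ∷ [] ,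
      trans (cong (_* +) (switch e)) (*-assoc (ε u * ε w) (H.sign (π u) (π w)) +)
    project {u} (v ∷ vs) {w} (e ∷ l) with project vs l
    ... | p , eq = π-~ e ∷ p , (begin
      G.sign u v * walkSign G (v ∷ (vs ∷ʳ w))
        ≡⟨ cong₂ _*_ (switch e) eq ⟩
      ((ε u * ε v) * s) * ((ε v * ε w) * t)
        ≡⟨ solve 5 (λ a b c s t → ((a ⊕ b) ⊕ s) ⊕ ((b ⊕ c) ⊕ t) ⊜ (b ⊕ b) ⊕ ((a ⊕ c) ⊕ (s ⊕ t)))
                 refl (ε u) (ε v) (ε w) s t ⟩
      (ε v * ε v) * ((ε u * ε w) * (s * t))
        ≡⟨ cong (_* ((ε u * ε w) * (s * t))) (s*s≡+ (ε v)) ⟩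
      (ε u * ε w) * (s * t) ∎)
      where
      s = H.sign (π u) (π v)
      t = walkSign H (map π (v ∷ (vs ∷ʳ w)))

    -- The image of a cycle may revisit vertices, so it is treated as a closed walk in `H`. Its two
    -- end factors coincide and cancel.
    balanced-pullback : DecidableEquality H.Vertex → (∀ {v} → ¬ v H.~ v) → Balanced H → Balanced G
    balanced-pullback _≟_ irrefl bal {v} {vs} c with project vs (IsCycle.linked c)
    ... | p , eq = trans eq (cong₂ _*_ (s*s≡+ (ε v)) (closed-walk-sign _≟_ irrefl bal p))

-- Inversions

*-flip : ∀ s {t u} → t ≡ s * u → u ≡ s * t
*-flip + eq = sym eq
*-flip - {u = + } refl = refl
*-flip - {u = - } refl = refl

-- `permSign xs ys` unfolds to `s[ xs ] * s[ ys ]`.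
s[_] : List (Fin n) → Sign
s[ xs ] = -1^ inversions xs

-1^-+ : ∀ a b → -1^ (a ℕ.+ b) ≡ (-1^ a) * (-1^ b)
-1^-+ ℕ.zero  b = refl
-1^-+ (suc a) b = begin
  - * (-1^ (a ℕ.+ b))       ≡⟨ cong (- *_) (-1^-+ a b) ⟩
  - * ((-1^ a) * (-1^ b))   ≡⟨ *-assoc - (-1^ a) (-1^ b) ⟨
  (- * (-1^ a)) * (-1^ b)   ∎

below : Fin n → List (Fin n) → ℕ
below x = length ∘ filter (_<? x)

below-↭ : ∀ (x : Fin n) {xs ys} → xs ↭ ys → below x xs ≡ below x ys
below-↭ x = ↭-length ∘ filter-↭ (_<? x)

s-∷ : ∀ (x : Fin n) xs → s[ x ∷ xs ] ≡ (-1^ below x xs) * s[ xs ]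
s-∷ x xs = -1^-+ (below x xs) (inversions xs)

-- For a ≢ x exactly one of the pairs (a , x), (x , a) is a descent.
below-swap : ∀ {a x : Fin n} → a ≢ x → ∀ xs →
             (-1^ below a (x ∷ xs)) * (-1^ below x xs) ≡
             - * ((-1^ below a xs) * (-1^ below x (a ∷ xs)))
below-swap {a = a} {x} a≢x xs with Fin.<-cmp a x
... | tri< a<x _ x≮a
  rewrite filter-reject (_<? a) {xs = xs} x≮a | filter-accept (_<? x) {xs = xs} a<x =
  solve 3 (λ e p q → (e ⊕ e) ⊕ (p ⊕ q) ⊜ e ⊕ (p ⊕ (e ⊕ q))) refl - (-1^ below a xs) (-1^ below x xs)
... | tri≈ _ a≡x _ = contradiction a≡x a≢x
... | tri> a≮x _ x<a
  rewrite filter-accept (_<? a) {xs = xs} x<a | filter-reject (_<? x) {xs = xs} a≮x =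
  *-assoc - (-1^ below a xs) (-1^ below x xs)

-- Moving `x` to the front passes each entry of `as` once and flips the sign each time; at the
-- front, `x` is inverted with exactly the smaller entries.
s-middle : ∀ as {x : Fin n} {bs} → All (_≢ x) as →
           s[ as ++ x ∷ bs ] ≡ (-1^ length as) * ((-1^ below x (as ++ bs)) * s[ as ++ bs ])
s-middle []       {x} {bs} []          = s-∷ x bs
s-middle (a ∷ as) {x} {bs} (a≢x ∷ as≢x) = begin
  s[ a ∷ as ++ x ∷ bs ]
    ≡⟨ s-∷ a (as ++ x ∷ bs) ⟩
  (-1^ below a (as ++ x ∷ bs)) * s[ as ++ x ∷ bs ]
    -- `below a` does not depend on the order of the list, so `x` may be moved to the front.
    ≡⟨ cong₂ (λ k t → (-1^ k) * t) (below-↭ a (shift x as bs)) (s-middle as as≢x) ⟩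
  p * (l * (q * t))
    ≡⟨ solve 4 (λ p l q t → p ⊕ (l ⊕ (q ⊕ t)) ⊜ (p ⊕ q) ⊕ (l ⊕ t)) refl p l q t ⟩
  (p * q) * (l * t)
    ≡⟨ cong (_* (l * t)) (below-swap a≢x xs) ⟩
  (- * (p′ * q′)) * (l * t)
    ≡⟨ solve 5 (λ e p q l t → (e ⊕ (p ⊕ q)) ⊕ (l ⊕ t) ⊜ (e ⊕ l) ⊕ (q ⊕ (p ⊕ t))) refl - p′ q′ l t ⟩
  (- * l) * (q′ * (p′ * t))
    ≡⟨ cong (λ r → (- * l) * (q′ * r)) (s-∷ a xs) ⟨
  (- * l) * (q′ * s[ a ∷ xs ]) ∎
  where
  xs = as ++ bs
  p = -1^ below a (x ∷ xs)
  q = -1^ below x xs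
  p′ = -1^ below a xs
  q′ = -1^ below x (a ∷ xs)
  l = -1^ length as
  t = s[ xs ]

-- Orderings

ordering-↭ : {F : Subset n} (o o′ : Ordering F) → list o ↭ list o′
ordering-↭ o o′ = ∼bag⇒↭ (unique∧set⇒bag (unique o) (unique o′)
  (mk⇔ (from (complete o′) ∘ to (complete o)) (from (complete o) ∘ to (complete o′))))

-- The increasing ordering, used as reference orientation. Since all of these are filters of one
-- list, the ordering of a face restricts to those of its subsets.
elements : (F : Subset n) → Ordering F
elements {n} F = record
  { list     = filter (_∈? F) (allFin n)
  ; unique   = filter⁺ (_∈? F) (allFin⁺ n)
  ; complete = mk⇔ (proj₂ ∘ ∈-filter⁻ (_∈? F) {xs = allFin n}) (∈-filter⁺ (_∈? F) {xs = allFin n} (∈-allFin _))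
  }

-- Stated for an arbitrary `g` so that the induction can pass to `g ∘ suc`.
count-tabulate : ∀ {A : Set} {P : Pred A 0ℓ} (P? : Decidable P) (g : Fin n → A) (F : Subset n) →
                 (∀ i → P (g i) ⇔ i ∈ F) → length (filter P? (tabulate g)) ≡ ∣ F ∣
count-tabulate P? g []            h = refl
count-tabulate P? g (outside ∷ F) h
  rewrite filter-reject P? {xs = tabulate (g ∘ suc)} ((λ ()) ∘ to (h zero)) =
  count-tabulate P? (g ∘ suc) F λ i → mk⇔ (drop-there ∘ to (h (suc i))) (from (h (suc i)) ∘ there)
count-tabulate P? g (inside ∷ F)  h
  rewrite filter-accept P? {xs = tabulate (g ∘ suc)} (from (h zero) here) =
  cong suc (count-tabulate P? (g ∘ suc) F λ i →
    mk⇔ (drop-there ∘ to (h (suc i))) (from (h (suc i)) ∘ there))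

length-ordering : {F : Subset n} (o : Ordering F) → length (list o) ≡ ∣ F ∣
length-ordering {F = F} o =
  trans (↭-length (ordering-↭ o (elements F))) (count-tabulate (_∈? F) id F λ _ → mk⇔ id id)

filter-⊆ : ∀ {A : Set} {P Q : Pred A 0ℓ} (P? : Decidable P) (Q? : Decidable Q) →
           (∀ {x} → P x → Q x) → ∀ xs → filter P? (filter Q? xs) ≡ filter P? xs
filter-⊆ P? Q? P⊆Q [] = refl
filter-⊆ P? Q? P⊆Q (x ∷ xs) with Q? x
... | no ¬q = trans (filter-⊆ P? Q? P⊆Q xs) (sym (filter-reject P? (¬q ∘ P⊆Q)))
... | yes _ with P? x
...   | yes _ = cong (x ∷_) (filter-⊆ P? Q? P⊆Q xs)
...   | no _  = filter-⊆ P? Q? P⊆Q xs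

-- Facets

record Facet (F F̄ : Subset n) (x : Fin n) : Set where
  field
    x∉F : x ∉ F
    F̄⇔  : ∀ {y} → y ∈ F̄ ⇔ (y ≡ x ⊎ y ∈ F)

-- After the first rejected entry the remaining list is as long as its own filter, so nothing else
-- is rejected.
filter-one-out : ∀ {A : Set} {P : Pred A 0ℓ} (P? : Decidable P) xs →
                 suc (length (filter P? xs)) ≡ length xs →
                 ∃ λ as → ∃₂ λ x bs → xs ≡ as ++ x ∷ bs × All P as × ¬ P x × All P bs
filter-one-out {P = P} P? (x ∷ xs) eq with P? x
... | no ¬p = [] , x , xs , refl , [] , ¬p ,
  subst (All P) (filter-complete P? (suc-injective eq)) (all-filter P? xs)
... | yes p with filter-one-out P? xs (suc-injective eq)
...   | as , y , bs , refl , pas , ¬py , pbs = x ∷ as , y , bs , refl , p ∷ pas , ¬py , pbs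

⊆⇒facet : {F F̄ : Subset n} → F ⊆ F̄ → suc ∣ F ∣ ≡ ∣ F̄ ∣ → ∃ (Facet F F̄)
⊆⇒facet {F = F} {F̄} F⊆F̄ eq with filter-one-out (_∈? F) (list (elements F̄)) (begin
    suc (length (filter (_∈? F) (list (elements F̄))))
      ≡⟨ cong (suc ∘ length) (filter-⊆ (_∈? F) (_∈? F̄) F⊆F̄ (allFin _)) ⟩
    suc (length (list (elements F))) ≡⟨ cong suc (length-ordering (elements F)) ⟩
    suc ∣ F ∣                        ≡⟨ eq ⟩
    ∣ F̄ ∣                            ≡⟨ length-ordering (elements F̄) ⟨
    length (list (elements F̄))       ∎)
... | as , x , bs , xs≡ , pas , x∉F , pbs = x , record { x∉F = x∉F ; F̄⇔ = mk⇔ f g }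
  where
  F̄-list = complete (elements F̄)
  f : ∀ {y} → y ∈ F̄ → y ≡ x ⊎ y ∈ F
  f y∈F̄ with ∈ˡ-++⁻ as (subst (_ ∈ˡ_) xs≡ (from F̄-list y∈F̄))
  ... | inj₁ y∈as          = inj₂ (All.lookup pas y∈as)
  ... | inj₂ (here y≡x)    = inj₁ y≡x
  ... | inj₂ (there y∈bs)  = inj₂ (All.lookup pbs y∈bs)
  g : ∀ {y} → y ≡ x ⊎ y ∈ F → y ∈ F̄
  g (inj₁ refl) = to F̄-list (subst (_ ∈ˡ_) (sym xs≡) (∈-++⁺ʳ as (here refl)))
  g (inj₂ y∈F)  = F⊆F̄ y∈F

-- `rest` is the ordering of `F` induced by `ō`, and the length of `as` is the index of `x` in `ō`,
-- the exponent in the boundary sign.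
record Removal (F : Subset n) {F̄ : Subset n} (ō : Ordering F̄) (x : Fin n) : Set where
  field
    as bs : List (Fin n)
    split : list ō ≡ as ++ x ∷ bs
    rest  : Ordering F
    rest≡ : list rest ≡ as ++ bs

removal : {F F̄ : Subset n} {x : Fin n} → Facet F F̄ x → (ō : Ordering F̄) → Removal F ō x
removal {F = F} {F̄} {x} fc ō with ∈-∃++ (from (complete ō) (from (Facet.F̄⇔ fc) (inj₁ refl)))
... | as , bs , eq with Unique-shift as (subst Unique eq (unique ō))
... | x∉ ∷ u = record
  { as = as ; bs = bs ; split = eq ; rest≡ = refl
  ; rest = record { list = as ++ bs ; unique = u ; complete = mk⇔ f g } }
  where
  f : ∀ {y} → y ∈ˡ as ++ bs → y ∈ F
  f y∈ with to (Facet.F̄⇔ fc) (to (complete ō)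
              (subst (_ ∈ˡ_) (sym eq) (∈-resp-↭ (↭-sym (shift x as bs)) (there y∈))))
  ... | inj₁ refl = contradiction refl (All.lookup x∉ y∈)
  ... | inj₂ y∈F  = y∈F
  g : ∀ {y} → y ∈ F → y ∈ˡ as ++ bs
  g y∈F with ∈-resp-↭ (shift x as bs)
               (subst (_ ∈ˡ_) eq (from (complete ō) (from (Facet.F̄⇔ fc) (inj₂ y∈F))))
  ... | here refl = contradiction y∈F (Facet.x∉F fc)
  ... | there y∈  = y∈

module _ {A : Set} {P : Pred A 0ℓ} (P? : Decidable P) where

  filter-skip : ∀ as {x bs} → All P as → ¬ P x → All P bs → filter P? (as ++ x ∷ bs) ≡ as ++ bs
  filter-skip as {x} {bs} pas ¬px pbs = begin
    filter P? (as ++ x ∷ bs)          ≡⟨ filter-++ P? as (x ∷ bs) ⟩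
    filter P? as ++ filter P? (x ∷ bs) ≡⟨ cong₂ _++_ (filter-all P? pas) (filter-reject P? ¬px) ⟩
    as ++ filter P? bs                ≡⟨ cong (as ++_) (filter-all P? pbs) ⟩
    as ++ bs                          ∎

  takeWhile-until : ∀ {as x bs} → All P as → ¬ P x → takeWhile P? (as ++ x ∷ bs) ≡ as
  takeWhile-until {x = x} [] ¬px with P? x
  ... | yes px = contradiction px ¬px
  ... | no _   = refl
  takeWhile-until {as = a ∷ _} (pa ∷ pas) ¬px with P? a
  ... | yes _  = cong (a ∷_) (takeWhile-until pas ¬px)
  ... | no ¬pa = contradiction pa ¬pa

-- Incidence signs in terms of inversions

module _ {F F̄ : Subset n} {x : Fin n} (fc : Facet F F̄ x) where
  open Removal

  rest⊆F : (ō : Ordering F̄) (r : Removal F ō x) → All (_∈ F) (as r) × All (_∈ F) (bs r)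
  rest⊆F ō r = All.++⁻ (as r) (All.tabulate λ y∈ →
    to (complete (rest r)) (subst (_ ∈ˡ_) (sym (rest≡ r)) y∈))

  filter-ordering : (ō : Ordering F̄) (r : Removal F ō x) → filter (_∈? F) (list ō) ≡ as r ++ bs r
  filter-ordering ō r with rest⊆F ō r
  ... | as⊆F , bs⊆F = trans (cong (filter (_∈? F)) (split r))
                            (filter-skip (_∈? F) (as r) as⊆F (Facet.x∉F fc) bs⊆F)

  incidence-removal : (o : Ordering F) (ō : Ordering F̄) (r : Removal F ō x) →
                      incidence o ō ≡ (-1^ length (as r)) * permSign (as r ++ bs r) (list o)
  incidence-removal o ō r = cong₂ (λ k xs → (-1^ k) * permSign xs (list o))
    (cong length (trans (cong (takeWhile (_∈? F)) (split r))
                        (takeWhile-until (_∈? F) (proj₁ (rest⊆F ō r)) (Facet.x∉F fc))))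
    (filter-ordering ō r)

  -- For the induced ordering the permutation sign is a square, which leaves the position of `x`.
  incidence-induced : (o : Ordering F) (ō : Ordering F̄) (r : Removal F ō x) → list o ≡ as r ++ bs r →
                      incidence o ō ≡ -1^ length (as r)
  incidence-induced o ō r eq = begin
    incidence o ō ≡⟨ incidence-removal o ō r ⟩
    l * (s[ as r ++ bs r ] * s[ list o ]) ≡⟨ cong (λ xs → l * (s[ xs ] * s[ list o ])) eq ⟨
    l * (s[ list o ] * s[ list o ])       ≡⟨ cong (l *_) (s*s≡+ s[ list o ]) ⟩
    l * +                                 ≡⟨ *-comm l + ⟩
    l ∎
    where l = -1^ length (as r)

  -- Separates the orientations from the geometry: the first two factors belong to one face each and
  -- form a switching, while the last depends only on `F` and `x`.
  incidence-below : (o : Ordering F) (ō : Ordering F̄) →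
                    incidence o ō ≡ (s[ list o ] * s[ list ō ]) * (-1^ below x (list (elements F)))
  incidence-below o ō = begin
    incidence o ō
      ≡⟨ incidence-removal o ō r ⟩
    l * (t * u)
      -- Inserting `b * b` supplies the factor needed to apply `s-middle` backwards.
      ≡⟨ cong (_* (l * (t * u))) (s*s≡+ b) ⟨
    (b * b) * (l * (t * u))
      ≡⟨ solve 4 (λ l t u b → (b ⊕ b) ⊕ (l ⊕ (t ⊕ u)) ⊜ (u ⊕ (l ⊕ (b ⊕ t))) ⊕ b) refl l t u b ⟩
    (u * (l * (b * t))) * b
      ≡⟨ cong (λ v → (u * v) * b) (s-middle (as r) x∉as) ⟨
    (u * s[ as r ++ x ∷ bs r ]) * b
      ≡⟨ cong₂ (λ xs k → (u * s[ xs ]) * (-1^ k)) (split r) (below-↭ x rest-↭) ⟨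
    (u * s[ list ō ]) * (-1^ below x (list (elements F))) ∎
    where
    r = removal fc ō
    l = -1^ length (as r)
    t = s[ as r ++ bs r ]
    u = s[ list o ]
    b = -1^ below x (as r ++ bs r)
    x∉as : All (_≢ x) (as r)
    x∉as = All.map (λ { y∈F refl → Facet.x∉F fc y∈F }) (proj₁ (rest⊆F ō r))
    rest-↭ : list (elements F) ↭ as r ++ bs r
    rest-↭ = subst (list (elements F) ↭_) (rest≡ r) (ordering-↭ (elements F) (rest r))

-- Images

-- A relation, so that explicitly given subsets such as `F ++ᵥ ∅` and `merge A` can serve as images.
IsImage : (Fin m → Fin n) → Subset m → Subset n → Set
IsImage f F G = ∀ {w} → w ∈ G ⇔ ∃ λ v → v ∈ F × f v ≡ w

InjectiveOn : (Fin m → Fin n) → Subset m → Set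
InjectiveOn f F = ∀ {v w} → v ∈ F → w ∈ F → f v ≡ f w → v ≡ w

module _ (f : Fin m → Fin n) where

  map-unique : ∀ {xs} → (∀ {v w} → v ∈ˡ xs → w ∈ˡ xs → f v ≡ f w → v ≡ w) →
               Unique xs → Unique (map f xs)
  map-unique inj [] = []
  map-unique inj (x∉ ∷ u) =
    All.map⁺ (All.tabulate λ y∈ eq → All.lookup x∉ y∈ (inj (here refl) (there y∈) eq)) ∷
    map-unique (λ v∈ w∈ → inj (there v∈) (there w∈)) u

  image : {F : Subset m} {G : Subset n} → IsImage f F G → InjectiveOn f F → Ordering F → Ordering G
  image {F} {G} im inj o = record
    { list     = map f (list o)
    ; unique   = map-unique (λ v∈ w∈ → inj (to (complete o) v∈) (to (complete o) w∈)) (unique o)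
    ; complete = mk⇔ fwd bwd
    }
    where
    fwd : ∀ {w} → w ∈ˡ map f (list o) → w ∈ G
    fwd w∈ with ∈-map⁻ f w∈
    ... | v , v∈ , eq = from im (v , to (complete o) v∈ , sym eq)
    bwd : ∀ {w} → w ∈ G → w ∈ˡ map f (list o)
    bwd w∈ with to im w∈
    ... | v , v∈ , refl = ∈-map⁺ f (from (complete o) v∈)

  -- An ordering of `F` is carried to an ordering of `G` of the same length.
  ∣image∣ : {F : Subset m} {G : Subset n} → IsImage f F G → InjectiveOn f F → ∣ G ∣ ≡ ∣ F ∣
  ∣image∣ {F} {G} im inj = begin
    ∣ G ∣                             ≡⟨ length-ordering (image im inj (elements F)) ⟨
    length (map f (list (elements F))) ≡⟨ length-map f (list (elements F)) ⟩
    length (list (elements F))        ≡⟨ length-ordering (elements F) ⟩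
    ∣ F ∣                             ∎

  -- The switching function: the sign of `o` against the increasing ordering of `F`, times the sign
  -- of the transported increasing ordering against `p`.
  distortion : {F : Subset m} {G : Subset n} → Ordering F → Ordering G → Sign
  distortion {F} o p =
    (s[ list o ] * s[ list (elements F) ]) * (s[ map f (list (elements F)) ] * s[ list p ])

  module _ {F F̄ : Subset m} {G Ḡ : Subset n} (im : IsImage f F G) (im̄ : IsImage f F̄ Ḡ)
           (inj : InjectiveOn f F) (in̄j : InjectiveOn f F̄) {x : Fin m} (fc : Facet F F̄ x) where

    facet-image : Facet G Ḡ (f x)
    facet-image = record { x∉F = fx∉G ; F̄⇔ = mk⇔ fwd bwd }
      where
      fx∉G : f x ∉ G
      fx∉G fx∈G with to im fx∈G
      ... | v , v∈F , eq with in̄j (from (Facet.F̄⇔ fc) (inj₂ v∈F)) (from (Facet.F̄⇔ fc) (inj₁ refl)) eq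
      ... | refl = Facet.x∉F fc v∈F
      fwd : ∀ {y} → y ∈ Ḡ → y ≡ f x ⊎ y ∈ G
      fwd y∈ with to im̄ y∈
      ... | v , v∈F̄ , refl with to (Facet.F̄⇔ fc) v∈F̄
      ... | inj₁ refl = inj₁ refl
      ... | inj₂ v∈F  = inj₂ (from im (v , v∈F , refl))
      bwd : ∀ {y} → y ≡ f x ⊎ y ∈ G → y ∈ Ḡ
      bwd (inj₁ refl) = from im̄ (x , from (Facet.F̄⇔ fc) (inj₁ refl) , refl)
      bwd (inj₂ y∈G) with to im y∈G
      ... | v , v∈F , eq = from im̄ (v , from (Facet.F̄⇔ fc) (inj₂ v∈F) , eq)

    -- Mapping a list keeps positions, so `f x` has the same index in the transported ordering as
    -- `x` has in the original one.
    incidence-image : incidence (elements F) (elements F̄) ≡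
                      incidence (image im inj (elements F)) (image im̄ in̄j (elements F̄))
    incidence-image = begin
      incidence (elements F) (elements F̄)
        ≡⟨ incidence-induced fc (elements F) (elements F̄) r F≡ ⟩
      -1^ length (Removal.as r)
        ≡⟨ cong -1^_ (length-map f (Removal.as r)) ⟨
      -1^ length (map f (Removal.as r))
        ≡⟨ incidence-induced facet-image (image im inj (elements F)) (image im̄ in̄j (elements F̄)) r′
             (trans (cong (map f) F≡) (map-++ f (Removal.as r) (Removal.bs r))) ⟨
      incidence (image im inj (elements F)) (image im̄ in̄j (elements F̄)) ∎
      where
      r = removal fc (elements F̄)
      -- The increasing ordering of `F` is the one induced by that of `F̄`, as `incidence-induced`
      -- requires.
      F≡ : list (elements F) ≡ Removal.as r ++ Removal.bs r
      F≡ = trans (sym (filter-⊆ (_∈? F) (_∈? F̄) (from (Facet.F̄⇔ fc) ∘ inj₂) (allFin m)))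
                 (filter-ordering fc (elements F̄) r)
      r′ : Removal G (image im̄ in̄j (elements F̄)) (f x)
      r′ = record
        { as    = map f (Removal.as r)
        ; bs    = map f (Removal.bs r)
        ; split = trans (cong (map f) (Removal.split r)) (map-++ f (Removal.as r) (x ∷ Removal.bs r))
        ; rest  = image im inj (Removal.rest r)
        ; rest≡ = trans (cong (map f) (Removal.rest≡ r)) (map-++ f (Removal.as r) (Removal.bs r))
        }

    -- Passes from `o` to the increasing ordering, through its image under `f`, to `p`. Each change
    -- of ordering within a complex costs one factor per face.
    incidence-switch : (o : Ordering F) (ō : Ordering F̄) (p : Ordering G) (p̄ : Ordering Ḡ) →
                       incidence o ō ≡ (distortion o p * distortion ō p̄) * incidence p p̄
    incidence-switch o ō p p̄ = begin
      incidence o ō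
        ≡⟨ incidence-below fc o ō ⟩
      (a * ā) * (-1^ below x (list (elements F)))
        -- `incidence-below` is solved for its `below` factor, every sign being its own inverse; the
        -- same is done at `f x` in the next step.
        ≡⟨ cong ((a * ā) *_) (*-flip (b * b̄) (incidence-below fc (elements F) (elements F̄))) ⟩
      (a * ā) * ((b * b̄) * incidence (elements F) (elements F̄))
        ≡⟨ cong (λ z → (a * ā) * ((b * b̄) * z))
             (trans incidence-image (trans (incidence-below facet-image (image im inj (elements F)) (image im̄ in̄j (elements F̄)))
               (cong ((c * c̄) *_) (*-flip (d * d̄) (incidence-below facet-image p p̄))))) ⟩
      (a * ā) * ((b * b̄) * ((c * c̄) * ((d * d̄) * incidence p p̄)))
        ≡⟨ solve 9 (λ a ā b b̄ c c̄ d d̄ z →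
             (a ⊕ ā) ⊕ ((b ⊕ b̄) ⊕ ((c ⊕ c̄) ⊕ ((d ⊕ d̄) ⊕ z))) ⊜
             (((a ⊕ b) ⊕ (c ⊕ d)) ⊕ ((ā ⊕ b̄) ⊕ (c̄ ⊕ d̄))) ⊕ z)
             refl a ā b b̄ c c̄ d d̄ (incidence p p̄) ⟩
      (distortion o p * distortion ō p̄) * incidence p p̄ ∎
      where
      a = s[ list o ]
      ā = s[ list ō ]
      b = s[ list (elements F) ]
      b̄ = s[ list (elements F̄) ]
      c = s[ map f (list (elements F)) ]
      c̄ = s[ map f (list (elements F̄)) ]
      d = s[ list p ]
      d̄ = s[ list p̄ ]

-- Nondegenerate simplicial maps

record NondegenerateMap (L : Complex m) (K : Complex n) : Set where
  field
    vertex    : Fin m → Fin n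
    face      : Subset m → Subset n
    face-K    : ∀ {F} → Face L F → Face K (face F)
    face-im   : ∀ {F} → IsImage vertex F (face F)
    injective : ∀ {F} → Face L F → InjectiveOn vertex F

module _ (i : ℕ) {L : Complex m} {K : Complex n} (φ : NondegenerateMap L K)
         (o : Orientation L) (o′ : Orientation K) where
  open NondegenerateMap φ
  private
    module G = SignedGraph (B i L o)
    module H = SignedGraph (B i K o′)

  -- The proof inside `S L j` is irrelevant, but it can be recovered because being a face and having
  -- a given cardinality are decidable.
  S-recompute : ∀ {j} (F : S L j) → Face L (value F) × ∣ value F ∣ ≡ suc j
  S-recompute (F , [ p ]) = recompute (face? L F ×-dec (∣ F ∣ ℕ.≟ _)) p

  S-map : ∀ {j} → S L j → S K j
  S-map F = face (value F) , [ face-K (proj₁ p) , trans (∣image∣ vertex face-im (injective (proj₁ p))) (proj₂ p) ]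
    where p = S-recompute F

  private
    π : G.Vertex → H.Vertex
    π = [ inj₁ ∘ S-map , inj₂ ∘ S-map ]′

    δ : ∀ {j} → S L j → Sign
    δ F = distortion vertex (o F) (o′ (S-map F))

    ε : G.Vertex → Sign
    ε = [ δ , δ ]′

    face-⊆ : ∀ {F F̄} → F ⊆ F̄ → face F ⊆ face F̄
    face-⊆ F⊆F̄ w∈ with to face-im w∈
    ... | v , v∈F , eq = from face-im (v , F⊆F̄ v∈F , eq)

    π-~ : ∀ {u v} → u G.~ v → π u H.~ π v
    π-~ {inj₁ _} {inj₂ _} = face-⊆
    π-~ {inj₂ _} {inj₁ _} = face-⊆

    switch-⊆ : (F : S L i) (F̄ : S L (suc i)) → value F ⊆ value F̄ →
               incidence (o F) (o F̄) ≡ (δ F * δ F̄) * incidence (o′ (S-map F)) (o′ (S-map F̄))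
    switch-⊆ F F̄ F⊆F̄ with S-recompute F | S-recompute F̄
    ... | F∈L , ∣F∣ | F̄∈L , ∣F̄∣ with ⊆⇒facet F⊆F̄ (trans (cong suc ∣F∣) (sym ∣F̄∣))
    ... | x , fc = incidence-switch vertex face-im face-im (injective F∈L) (injective F̄∈L) fc
                     (o F) (o F̄) (o′ (S-map F)) (o′ (S-map F̄))

    switch : ∀ {u v} → u G.~ v → G.sign u v ≡ (ε u * ε v) * H.sign (π u) (π v)
    switch {inj₁ F} {inj₂ F̄} F⊆F̄ = switch-⊆ F F̄ F⊆F̄
    switch {inj₂ F̄} {inj₁ F} F⊆F̄ =
      trans (switch-⊆ F F̄ F⊆F̄) (cong (_* incidence (o′ (S-map F)) (o′ (S-map F̄))) (*-comm (δ F) (δ F̄)))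

    irrefl : ∀ {v} → ¬ v H.~ v
    irrefl {inj₁ _} ()
    irrefl {inj₂ _} ()

    _≟_ : DecidableEquality H.Vertex
    _≟_ = Sum.≡-dec (Refinement._≟_ (Vec.≡-dec Bool._≟_)) (Refinement._≟_ (Vec.≡-dec Bool._≟_))

  balanced-nondegenerate : Balanced (B i K o′) → Balanced (B i L o)
  balanced-nondegenerate =
    balanced-pullback (B i L o) (B i K o′) π ε (λ {u} {v} → π-~ {u} {v}) (λ {u} {v} → switch {u} {v})
      _≟_ (λ {v} → irrefl {v})

-- Duplication

∈-++ᵥ⇔ : (U : Subset m) (W : Subset n) {x : Fin (m ℕ.+ n)} →
         x ∈ U ++ᵥ W ⇔ [ _∈ U , _∈ W ]′ (splitAt m x)
∈-++ᵥ⇔ []      W = mk⇔ id id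
∈-++ᵥ⇔ (_ ∷ U) W {zero}  = mk⇔ (λ { here → here }) (λ { here → here })
∈-++ᵥ⇔ {suc m} (_ ∷ U) W {suc x} with splitAt m x | ∈-++ᵥ⇔ U W {x}
... | inj₁ _ | h = mk⇔ (there ∘ to h ∘ drop-there) (there ∘ from h ∘ drop-there)
... | inj₂ _ | h = mk⇔ (to h ∘ drop-there) (there ∘ from h)

∈-++ᵥˡ : (U : Subset m) (W : Subset n) {x : Fin m} → x ∈ U → x ↑ˡ n ∈ U ++ᵥ W
∈-++ᵥˡ {m} {n} U W {x} x∈U =
  from (∈-++ᵥ⇔ U W) (subst [ _∈ U , _∈ W ]′ (sym (splitAt-↑ˡ m x n)) x∈U)

∈-++ᵥʳ : (U : Subset m) (W : Subset n) {x : Fin n} → x ∈ W → m ↑ʳ x ∈ U ++ᵥ W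
∈-++ᵥʳ {m} {n} U W {x} x∈W =
  from (∈-++ᵥ⇔ U W) (subst [ _∈ U , _∈ W ]′ (sym (splitAt-↑ʳ m n x)) x∈W)

module _ (K Σ : Complex n) where

  inclusion : NondegenerateMap K (K ^ Σ)
  inclusion = record
    { vertex    = _↑ˡ n
    ; face      = _++ᵥ ∅
    ; face-K    = old
    ; face-im   = λ {F} → mk⇔ (fwd F) λ { (v , v∈F , refl) → ∈-++ᵥˡ F ∅ v∈F }
    ; injective = λ _ _ _ → Fin.↑ˡ-injective n _ _
    }
    where
    fwd : ∀ (F : Subset n) {w} → w ∈ F ++ᵥ ∅ → ∃ λ v → v ∈ F × v ↑ˡ n ≡ w
    fwd F {w} w∈ with splitAt n w in eq | to (∈-++ᵥ⇔ F ∅) w∈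
    ... | inj₁ v | v∈F = v , v∈F , Fin.splitAt⁻¹-↑ˡ eq
    ... | inj₂ v | v∈∅ = contradiction v∈∅ ∉⊥

  forget : Fin (n ℕ.+ n) → Fin n
  forget = [ id , id ]′ ∘ splitAt n

  merge : Subset (n ℕ.+ n) → Subset n
  merge A = Vec.take n A ∪ Vec.drop n A

  merge-++ : ∀ (U W : Subset n) → merge (U ++ᵥ W) ≡ U ∪ W
  merge-++ U W with Vec.++-injective (Vec.take n (U ++ᵥ W)) U (Vec.take++drop≡id n (U ++ᵥ W))
  ... | eq , eq′ = cong₂ _∪_ eq eq′

  forget-image : ∀ (U W : Subset n) → IsImage forget (U ++ᵥ W) (U ∪ W)
  forget-image U W = mk⇔ fwd bwd
    where
    fwd : ∀ {w} → w ∈ U ∪ W → ∃ λ v → v ∈ U ++ᵥ W × forget v ≡ w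
    fwd {w} w∈ with x∈p∪q⁻ U W w∈
    ... | inj₁ w∈U = w ↑ˡ n , ∈-++ᵥˡ U W w∈U , cong [ id , id ]′ (splitAt-↑ˡ n w n)
    ... | inj₂ w∈W = n ↑ʳ w , ∈-++ᵥʳ U W w∈W , cong [ id , id ]′ (splitAt-↑ʳ n n w)
    bwd : ∀ {w} → (∃ λ v → v ∈ U ++ᵥ W × forget v ≡ w) → w ∈ U ∪ W
    bwd (v , v∈ , refl) with splitAt n v | to (∈-++ᵥ⇔ U W) v∈
    ... | inj₁ _ | v∈U = x∈p∪q⁺ (inj₁ v∈U)
    ... | inj₂ _ | v∈W = x∈p∪q⁺ (inj₂ v∈W)

  -- `forget` is injective on each summand, so it can only identify a vertex with its own copy;
  -- disjointness excludes having both.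
  forget-injective : ∀ (U W : Subset n) → (∀ {x} → x ∈ U → x ∉ W) → InjectiveOn forget (U ++ᵥ W)
  forget-injective U W disjoint {v} {w} v∈ w∈ eq
    with splitAt n v in eqv | to (∈-++ᵥ⇔ U W) v∈ | splitAt n w in eqw | to (∈-++ᵥ⇔ U W) w∈
  ... | inj₁ x | _   | inj₁ y | _   =
    trans (sym (Fin.splitAt⁻¹-↑ˡ eqv)) (trans (cong (_↑ˡ n) eq) (Fin.splitAt⁻¹-↑ˡ eqw))
  ... | inj₂ x | _   | inj₂ y | _   =
    trans (sym (Fin.splitAt⁻¹-↑ʳ eqv)) (trans (cong (n ↑ʳ_) eq) (Fin.splitAt⁻¹-↑ʳ eqw))
  ... | inj₁ x | x∈U | inj₂ y | y∈W = contradiction (subst (_∈ W) (sym eq) y∈W) (disjoint x∈U)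
  ... | inj₂ x | x∈W | inj₁ y | y∈U = contradiction (subst (_∈ W) eq x∈W) (disjoint y∈U)

  module _ (Σ⊆K : ∀ {F} → Face Σ F → Face K F) where

    -- A vertex of `Σ` lies in `cl Σ`, hence in `st (cl Σ)`, which the link leaves out.
    link-disjoint : ∀ {v} → Vertices (Face Σ) v → ¬ Vertices (lk K (Face Σ)) v
    link-disjoint v∈Σ (_ , ∉st) = ∉st (Σ⊆K v∈Σ , _ , cl-⊇ K Σ⊆K v∈Σ , id)

    projection : NondegenerateMap (K ^ Σ) K
    projection = record
      { vertex    = forget
      ; face      = merge
      ; face-K    = face-K
      ; face-im   = λ {A} → face-im A
      ; injective = injective
      }
      where
      face-K : ∀ {A} → DupFace K Σ A → Face K (merge A)
      face-K (old {F} f)           = subst (Face K) (sym (trans (merge-++ F ∅) (∪-identityʳ F))) f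
      face-K (new {W} {U} _ _ _ f) = subst (Face K) (sym (trans (merge-++ U W) (∪-comm U W))) f
      face-im : ∀ A → IsImage forget A (merge A)
      face-im A = subst (λ A′ → IsImage forget A′ (merge A)) (Vec.take++drop≡id n A)
                        (forget-image (Vec.take n A) (Vec.drop n A))
      injective : ∀ {A} → DupFace K Σ A → InjectiveOn forget A
      injective (old {F} _)           = forget-injective F ∅ (λ _ → ∉⊥)
      injective (new {W} {U} _ v u _) = forget-injective U W (λ x∈U x∈W → link-disjoint (v x∈W) (u x∈U))

mainTheorem14 : ∀ {n : ℕ} (i : ℕ) (K Σ : Complex n) →
    (o : Orientation K) (o′ : Orientation (K ^ Σ)) →
    Connected (B i K o) → IsMotif i K Σ →
    Balanced (B i (K ^ Σ) o′) ⇔ Balanced (B i K o)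
mainTheorem14 i K Σ o o′ _ motif = mk⇔
  (balanced-nondegenerate i (inclusion K Σ) o o′)
  (balanced-nondegenerate i (projection K Σ (IsMotif.subcomplex motif)) o′ o)
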